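{- Let $\mathcal{P}(\mathbb{N})$ be Scott's graph model and let $C:\mathcal{P}(\mathbb{N})\to\mathcal{P}(\mathbb{N})$, $C(A)=\mathbb{N}-A$, be the complement function. Then the pca $\mathcal{P}(\mathbb{N})[C]$ is decidable.
   Context: A partial combinatory algebra (pca) is a set $\mathcal{A}$ with a partial binary application $(a,b)\mapsto ab$ (associating to the left) such that there are $\mathsf{k},\mathsf{s}\in\mathcal{A}$ with, for all $a,b,c$: $\mathsf{k}ab=a$; $\mathsf{s}ab$ is defined; and whenever $(ac)(bc)$ is defined, $\mathsf{s}abc$ is defined and equals $(ac)(bc)$. A partial function $f:\mathcal{A}^n\to\mathcal{A}$ is representable in $\mathcal{A}$ if there is $a_f\in\mathcal{A}$ with $a_fa_1\cdots a_n=f(a_1,\ldots,a_n)$ for all $(a_1,\ldots,a_n)$ in the domain of $f$. Every pca contains booleans $\mathsf{T},\mathsf{F}$ with a definition-by-cases element $D$ ($D\mathsf{T}ab=a$, $D\mathsf{F}ab=b$), and standard codings $[a,b]$ of pairs and $[a_0,\ldots,a_{n-1}]$ of finite sequences whose basic operations (length, projections, appending) are representable; fix such choices. A pca $\mathcal{A}$ is decidable if the function sending each coded pair $[a,b]$ to $\mathsf{T}$ if $a=b$ and to $\mathsf{F}$ otherwise is representable in $\mathcal{A}$. For a pca $\mathcal{A}$ and a partial function $f:\mathcal{A}\to\mathcal{A}$, $\mathcal{A}[f]$ is the pca with underlying set $\mathcal{A}$ and application $\cdot_f$ defined by: $a\cdot_f b=c$ iff there is a finite sequence $e_0,\ldots,e_{n-1}$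 in $\mathcal{A}$ (on each of which $f$ is defined) such that $a[b,f(e_0),\ldots,f(e_{i-1})]=[\mathsf{F},e_i]$ for all $i<n$ and $a[b,f(e_0),\ldots,f(e_{n-1})]=[\mathsf{T},c]$. (It is known that this is a pca, that $f$ is representable in it, and that application of $\mathcal{A}$ is representable in it.) Scott's graph model is the set $\mathcal{P}(\mathbb{N})$ of subsets of $\mathbb{N}$ with application $A\circ B=\{n\mid \exists m\,([m,n]\in A,\ e_m\subseteq B)\}$, where $[\cdot,\cdot]$ is a standard bijective pairing on $\mathbb{N}$ and $e_k$ is the finite set $p$ with $k=\sum_{i\in p}2^i$. -}

module Defs where

open import Level using (Level; _⊔_; 0ℓ) renaming (suc to lsuc)
open import Data.Bool using (Bool; true; false)
open import Data.Empty using (⊥-elim)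
open import Data.Fin using (Fin; toℕ) renaming (zero to fzero; suc to fsuc)
open import Data.List using (List; []; _∷_; _++_; _∷ʳ_; length; lookup; take; tabulate; filter; upTo)
open import Data.List.Properties using (∷ʳ-++; ++-identityʳ)
open import Data.List.Membership.Propositional renaming (_∈_ to _∈ˡ_)
open import Data.List.Membership.Propositional.Properties using (∈-filter⁺; ∈-filter⁻; ∈-upTo⁺; ∈-++⁺ˡ; ∈-++⁺ʳ; ∈-++⁻)
import Data.List.Membership.DecPropositional as DecMembership
open import Data.List.Relation.Unary.Any using (here; there)
open import Data.List.Relation.Binary.Pointwise as Pointwise using (Pointwise; []; _∷_)
open import Data.Nat using (ℕ; zero; suc; pred; _+_; _*_; _^_; _/_; _%_; _≤_; _<_; z≤n; s≤s; _≟_; _<?_)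
open import Data.Nat.DivMod
open import Data.Nat.Divisibility using (divides-refl)
open import Data.Nat.ListAction using (sum)
open import Data.Nat.Properties hiding (_≟_; _<?_)
open import Data.Product using (Σ-syntax; ∃-syntax; _×_; _,_; proj₁; proj₂)
open import Data.Sum using (_⊎_; [_,_]′)
open import Data.Vec using (Vec; []; _∷_)
open import Function using (_↔_; Inverse; Injection)
open import Function.Properties.Inverse using (↔⇒↣)
open import Relation.Binary using (Rel; IsEquivalence)
open import Relation.Binary.PropositionalEquality using (_≡_; refl; sym; trans; cong; cong₂; subst)
open import Relation.Nullary using (¬_; Dec; yes; no; does)
open import Relation.Nullary.Decidable using (dec-true; map′)
open import Relation.Unary using (Pred; _∈_; _⊆_; _≐_; ∁)
open import Relation.Unary.Properties using (≐-refl; ≐-sym; ≐-trans)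
open import Relation.Unary.Relation.Binary.Equality using (≐-isEquivalence)

private
  variable
    c ℓ₁ ℓ₂ ℓ₃ : Level

-- Sets are setoids, and a partial operation is given by its graph:
-- a · b ↦ x says that ab is defined and equal to x.
record PartialApplicativeStructure c ℓ₁ ℓ₂ : Set (lsuc (c ⊔ ℓ₁ ⊔ ℓ₂)) where
  field
    Carrier       : Set c
    _≈_           : Rel Carrier ℓ₁
    isEquivalence : IsEquivalence _≈_
    _·_↦_         : Carrier → Carrier → Carrier → Set ℓ₂
    ·-resp        : ∀ {a a′ b b′ x x′} → a ≈ a′ → b ≈ b′ → x ≈ x′ →
                    a · b ↦ x → a′ · b′ ↦ x′
    ·-functional  : ∀ {a b x y} → a · b ↦ x → a · b ↦ y → x ≈ y

  open IsEquivalence isEquivalence public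
    renaming (refl to ≈-refl; sym to ≈-sym; trans to ≈-trans)

  -- a ·* (a₁ ∷ … ∷ aₙ ∷ []) ↦ x says that a a₁ ⋯ aₙ is defined and equal to x.
  _·*_↦_ : ∀ {n} → Carrier → Vec Carrier n → Carrier → Set (c ⊔ ℓ₁ ⊔ ℓ₂)
  _·*_↦_ a []       x = Level.Lift (c ⊔ ℓ₂) (a ≈ x)
  _·*_↦_ a (b ∷ bs) x = ∃[ y ] (a · b ↦ y) × (y ·* bs ↦ x)

  -- The partial function is given by its graph: G v y says that it is defined at v
  -- with value y.
  Representable : ∀ {n} → (Vec Carrier n → Carrier → Set ℓ₃) → Set (c ⊔ ℓ₁ ⊔ ℓ₂ ⊔ ℓ₃)
  Representable G = ∃[ a ] (∀ v y → G v y → a ·* v ↦ y)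

record IsPCA (A : PartialApplicativeStructure c ℓ₁ ℓ₂) : Set (c ⊔ ℓ₁ ⊔ ℓ₂) where
  open PartialApplicativeStructure A
  field
    k s   : Carrier
    k-law : ∀ a b → k ·* (a ∷ b ∷ []) ↦ a
    s-def : ∀ a b → ∃[ x ] s ·* (a ∷ b ∷ []) ↦ x
    s-law : ∀ {a b d x y z} → a · d ↦ x → b · d ↦ y → x · y ↦ z →
            s ·* (a ∷ b ∷ d ∷ []) ↦ z

record PCA c ℓ₁ ℓ₂ : Set (lsuc (c ⊔ ℓ₁ ⊔ ℓ₂)) where
  constructor mkPCA
  field
    structure : PartialApplicativeStructure c ℓ₁ ℓ₂
    isPCA     : IsPCA structure

  open PartialApplicativeStructure structure public
  open IsPCA isPCA public

module _ (A : PCA c ℓ₁ ℓ₂) where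
  open PCA A

  record Booleans : Set (c ⊔ ℓ₁ ⊔ ℓ₂) where
    field
      T F     : Carrier
      D       : Carrier
      D-true  : ∀ a b → D ·* (T ∷ a ∷ b ∷ []) ↦ a
      D-false : ∀ a b → D ·* (F ∷ a ∷ b ∷ []) ↦ b

  record Pairs : Set (c ⊔ ℓ₁ ⊔ ℓ₂) where
    field
      ⟦_,_⟧     : Carrier → Carrier → Carrier
      pair-cong : ∀ {a a′ b b′} → a ≈ a′ → b ≈ b′ → ⟦ a , b ⟧ ≈ ⟦ a′ , b′ ⟧
      pairing   : ∃[ p ] (∀ a b → p ·* (a ∷ b ∷ []) ↦ ⟦ a , b ⟧)
      fst       : ∃[ p ] (∀ a b → p · ⟦ a , b ⟧ ↦ a)
      snd       : ∃[ p ] (∀ a b → p · ⟦ a , b ⟧ ↦ b)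

  -- Lengths and indices are numerals, for which zero test, successor and
  -- predecessor are representable.
  record Sequences (B : Booleans) : Set (c ⊔ ℓ₁ ⊔ ℓ₂) where
    open Booleans B
    field
      num         : ℕ → Carrier
      successor   : ∃[ p ] (∀ n → p · num n ↦ num (suc n))
      predecessor : ∃[ p ] (∀ n → p · num n ↦ num (pred n))
      zero-test   : ∃[ p ] (p · num 0 ↦ T) × (∀ n → p · num (suc n) ↦ F)

      seq         : List Carrier → Carrier
      seq-cong    : ∀ {as bs} → Pointwise _≈_ as bs → seq as ≈ seq bs
      len         : ∃[ p ] (∀ as → p · seq as ↦ num (length as))
      projection  : ∃[ p ] (∀ as (i : Fin (length as)) →
                      p ·* (seq as ∷ num (toℕ i) ∷ []) ↦ lookup as i)
      append      : ∃[ p ] (∀ as a → p ·* (seq as ∷ a ∷ []) ↦ seq (as ∷ʳ a))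

  record Coding : Set (c ⊔ ℓ₁ ⊔ ℓ₂) where
    field
      booleans  : Booleans
      pairs     : Pairs
      sequences : Sequences booleans

    open Booleans booleans public
    open Pairs pairs public
    open Sequences sequences public

  EqualityTest : Booleans → Pairs → Vec Carrier 1 → Carrier → Set (c ⊔ ℓ₁)
  EqualityTest B P (x ∷ []) y =
    ∃[ a ] ∃[ b ] (x ≈ ⟦ a , b ⟧) × ((a ≈ b × y ≈ T) ⊎ (¬ (a ≈ b) × y ≈ F))
    where
    open Booleans B
    open Pairs P

  -- Any two choices of booleans and pairing are intertranslatable in A, so the
  -- notion does not depend on them; it is demanded for all choices.
  Decidable : Set (c ⊔ ℓ₁ ⊔ ℓ₂)
  Decidable = ∀ B P → Representable (EqualityTest B P)

  record PartialFunction ℓ₃ : Set (c ⊔ ℓ₁ ⊔ lsuc ℓ₃) where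
    field
      _↦_        : Carrier → Carrier → Set ℓ₃
      resp       : ∀ {a a′ b b′} → a ≈ a′ → b ≈ b′ → a ↦ b → a′ ↦ b′
      functional : ∀ {a b b′} → a ↦ b → a ↦ b′ → b ≈ b′

module Adjoin (A : PCA c ℓ₁ ℓ₂) (C : Coding A) (f : PartialFunction A ℓ₃) where
  open PCA A
  open Coding C
  open PartialFunction f

  -- d i is the value f(e i), and  b ∷ take i (tabulate d)  is the list
  -- b , f(e 0) , … , f(e (i-1)).
  _·ᶠ_↦_ : Carrier → Carrier → Carrier → Set (c ⊔ ℓ₂ ⊔ ℓ₃)
  a ·ᶠ b ↦ x =
    ∃[ n ] Σ[ e ∈ (Fin n → Carrier) ] Σ[ d ∈ (Fin n → Carrier) ]
      (∀ i → e i ↦ d i) ×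
      (∀ i → a · seq (b ∷ take (toℕ i) (tabulate d)) ↦ ⟦ F , e i ⟧) ×
      (a · seq (b ∷ tabulate d) ↦ ⟦ T , x ⟧)

  ·*-functional : ∀ {n a a′} (v : Vec Carrier n) {x y} → a ≈ a′ →
                  a ·* v ↦ x → a′ ·* v ↦ y → x ≈ y
  ·*-functional []      a≈a′ (Level.lift p) (Level.lift q) =
    ≈-trans (≈-sym p) (≈-trans a≈a′ q)
  ·*-functional (b ∷ v) a≈a′ (_ , p , ps) (_ , q , qs) =
    ·*-functional v (·-functional (·-resp a≈a′ ≈-refl ≈-refl p) q) ps qs

  resp₂ : ∀ {a b b′ y} → b ≈ b′ → a · b ↦ y → a · b′ ↦ y
  resp₂ p = ·-resp ≈-refl p ≈-refl

  fst-≈ : ∀ {a b a′ b′} → ⟦ a , b ⟧ ≈ ⟦ a′ , b′ ⟧ → a ≈ a′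
  fst-≈ p = ·-functional (resp₂ p (proj₂ fst _ _)) (proj₂ fst _ _)

  snd-≈ : ∀ {a b a′ b′} → ⟦ a , b ⟧ ≈ ⟦ a′ , b′ ⟧ → b ≈ b′
  snd-≈ p = ·-functional (resp₂ p (proj₂ snd _ _)) (proj₂ snd _ _)

  T≈F⇒trivial : T ≈ F → ∀ x y → x ≈ y
  T≈F⇒trivial p x y with D-true x y
  ... | _ , r , rs = ·*-functional (F ∷ x ∷ y ∷ []) ≈-refl
                       (_ , resp₂ p r , rs) (D-false x y)

  ≋-refl : ∀ {as} → Pointwise _≈_ as as
  ≋-refl = Pointwise.refl ≈-refl

  -- A run of a started on a list bs of which the oracle answers are appended.
  record Run (a : Carrier) (bs : List Carrier) (n : ℕ) (x : Carrier) : Set (c ⊔ ℓ₂ ⊔ ℓ₃) where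
    constructor run
    field
      e d   : Fin n → Carrier
      value : ∀ i → e i ↦ d i
      query : ∀ i → a · seq (bs ++ take (toℕ i) (tabulate d)) ↦ ⟦ F , e i ⟧
      halt  : a · seq (bs ++ tabulate d) ↦ ⟦ T , x ⟧

    query₀ : n ≡ 0 → a · seq bs ↦ ⟦ T , x ⟧
    query₀ refl = subst (λ l → a · seq l ↦ _) (++-identityʳ bs) halt

  open Run

  firstQuery : ∀ {a bs n x} (r : Run a bs (suc n) x) → a · seq bs ↦ ⟦ F , e r fzero ⟧
  firstQuery {bs = bs} r = subst (λ l → _ · seq l ↦ _) (++-identityʳ bs) (query r fzero)

  rest : ∀ {a bs n x} (r : Run a bs (suc n) x) → Run a (bs ∷ʳ d r fzero) n x
  rest {bs = bs} (run e d v q h) = run (λ i → e (fsuc i)) (λ i → d (fsuc i)) (λ i → v (fsuc i))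
    (λ i → subst (λ l → _ · seq l ↦ _) (sym (∷ʳ-++ bs _ _)) (q (fsuc i)))
    (subst (λ l → _ · seq l ↦ _) (sym (∷ʳ-++ bs _ _)) h)

  run-functional : ∀ {a bs bs′ x y} n n′ → Pointwise _≈_ bs bs′ →
                   Run a bs n x → Run a bs′ n′ y → x ≈ y
  run-functional zero zero p r r′ =
    snd-≈ (·-functional (resp₂ (seq-cong p) (query₀ r refl)) (query₀ r′ refl))
  run-functional zero (suc _) p r r′ = T≈F⇒trivial
    (fst-≈ (·-functional (resp₂ (seq-cong p) (query₀ r refl)) (firstQuery r′))) _ _
  run-functional (suc _) zero p r r′ = T≈F⇒trivial
    (≈-sym (fst-≈ (·-functional (resp₂ (seq-cong p) (firstQuery r)) (query₀ r′ refl)))) _ _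
  run-functional (suc n) (suc n′) p r r′ =
    run-functional n n′ (Pointwise.++⁺ p (d₀≈ ∷ [])) (rest r) (rest r′)
    where
    e₀≈ = snd-≈ (·-functional (resp₂ (seq-cong p) (firstQuery r)) (firstQuery r′))
    d₀≈ = functional (resp e₀≈ ≈-refl (value r fzero)) (value r′ fzero)

  structure[f] : PartialApplicativeStructure c ℓ₁ (c ⊔ ℓ₂ ⊔ ℓ₃)
  structure[f] = record
    { Carrier       = Carrier
    ; _≈_           = _≈_
    ; isEquivalence = isEquivalence
    ; _·_↦_         = _·ᶠ_↦_
    ; ·-resp        = λ { a≈ b≈ x≈ (n , e , d , v , q , h) → n , e , d , v
                        , (λ i → ·-resp a≈ (seq-cong (b≈ ∷ ≋-refl)) ≈-refl (q i))
                        , ·-resp a≈ (seq-cong (b≈ ∷ ≋-refl)) (pair-cong ≈-refl x≈) h }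
    ; ·-functional  = λ { (n , e , d , v , q , h) (n′ , e′ , d′ , v′ , q′ , h′) →
                        run-functional n n′ ≋-refl (run e d v q h) (run e′ d′ v′ q′ h′) }
    }

_[_,_] : (A : PCA c ℓ₁ ℓ₂) → Coding A → PartialFunction A ℓ₃ →
         PartialApplicativeStructure c ℓ₁ (c ⊔ ℓ₂ ⊔ ℓ₃)
A [ C , f ] = Adjoin.structure[f] A C f

-- i ∈ e k  iff  the coefficient of 2 ^ i in the binary expansion of k is 1.
-- (A record rather than a function, so that k and i can be inferred from e k i.)
record e (k i : ℕ) : Set where
  constructor is-one
  field
    digit : (k / 2 ^ i) {{m^n≢0 2 i}} % 2 ≡ 1

module FiniteSets where
  half : ∀ b v → b < 2 → (b + v * 2) / 2 ≡ v
  half b v b<2 = trans (+-distrib-/-∣ʳ b (divides-refl v)) (cong₂ _+_ (m<n⇒m/n≡0 b<2) (m*n/n≡m v 2))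

  zeroth : ∀ b v → (b + v * 2) / 1 % 2 ≡ b % 2
  zeroth b v = trans (cong (_% 2) (n/1≡n (b + v * 2))) ([m+kn]%n≡m%n b v 2)

  shift : ∀ b v i → b < 2 →
          ((b + v * 2) / 2 ^ suc i) {{m^n≢0 2 (suc i)}} % 2 ≡ (v / 2 ^ i) {{m^n≢0 2 i}} % 2
  shift b v i b<2 = cong (_% 2)
    (trans (sym (m/n/o≡m/[n*o] (b + v * 2) 2 (2 ^ i) {{_}} {{m^n≢0 2 i}} {{m^n≢0 2 (suc i)}}))
           (/-congˡ {{m^n≢0 2 i}} (half b v b<2)))

  bit : Bool → ℕ
  bit true  = 1
  bit false = 0

  bit<2 : ∀ b → bit b < 2
  bit<2 true  = s≤s (s≤s z≤n)
  bit<2 false = s≤s z≤n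

  bit-odd : ∀ b → bit b % 2 ≡ 1 → b ≡ true
  bit-odd true  _ = refl
  bit-odd false ()

  fromDigits : (ℕ → Bool) → ℕ → ℕ
  fromDigits t zero    = 0
  fromDigits t (suc N) = bit (t 0) + fromDigits (λ i → t (suc i)) N * 2

  e-0 : ∀ {i} → ¬ (i ∈ e 0)
  e-0 {i} (is-one p) with () ← trans (sym p) (cong (_% 2) (0/n≡0 (2 ^ i) {{m^n≢0 2 i}}))

  e-fromDigits⁺ : ∀ t N {i} → i < N → t i ≡ true → i ∈ e (fromDigits t N)
  e-fromDigits⁺ t (suc N) {zero} _ p =
    is-one (trans (zeroth (bit (t 0)) (fromDigits _ N)) (cong (λ b → bit b % 2) p))
  e-fromDigits⁺ t (suc N) {suc i} (s≤s q) p =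
    is-one (trans (shift (bit (t 0)) (fromDigits _ N) i (bit<2 (t 0)))
                  (e.digit (e-fromDigits⁺ (λ i → t (suc i)) N q p)))

  e-fromDigits⁻ : ∀ t N {i} → i ∈ e (fromDigits t N) → t i ≡ true
  e-fromDigits⁻ t zero p = ⊥-elim (e-0 p)
  e-fromDigits⁻ t (suc N) {zero} (is-one p) =
    bit-odd (t 0) (trans (sym (zeroth (bit (t 0)) (fromDigits _ N))) p)
  e-fromDigits⁻ t (suc N) {suc i} (is-one p) = e-fromDigits⁻ (λ i → t (suc i)) N
    (is-one (trans (sym (shift (bit (t 0)) (fromDigits _ N) i (bit<2 (t 0)))) p))

  open DecMembership _≟_ using (_∈?_)

  code : List ℕ → ℕ
  code L = fromDigits (λ i → does (i ∈? L)) (suc (sum L))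

  ∈⇒≤sum : ∀ {i L} → i ∈ˡ L → i ≤ sum L
  ∈⇒≤sum {L = x ∷ L} (here refl) = m≤m+n x (sum L)
  ∈⇒≤sum {L = x ∷ L} (there p)   = ≤-trans (∈⇒≤sum p) (m≤n+m (sum L) x)

  e-code⁺ : ∀ {L i} → i ∈ˡ L → i ∈ e (code L)
  e-code⁺ {L} {i} p = e-fromDigits⁺ (λ i → does (i ∈? L)) (suc (sum L)) (s≤s (∈⇒≤sum p)) (dec-true (i ∈? L) p)

  e-code⁻ : ∀ {L i} → i ∈ e (code L) → i ∈ˡ L
  e-code⁻ {L} {i} p with i ∈? L | e-fromDigits⁻ (λ i → does (i ∈? L)) (suc (sum L)) {i} p
  ... | yes q | _ = q
  ... | no  _ | ()

  n<2^n : ∀ n → n < 2 ^ n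
  n<2^n zero    = s≤s z≤n
  n<2^n (suc n) = ≤-trans (+-mono-≤ (m^n>0 2 n) (n<2^n n)) (+-monoʳ-≤ (2 ^ n) (m≤m+n (2 ^ n) 0))

  e⇒< : ∀ {m i} → i ∈ e m → i < m
  e⇒< {m} {i} (is-one p) with m <? 2 ^ i
  ... | no  q = ≤-trans (n<2^n i) (≮⇒≥ q)
  ... | yes q with () ← trans (sym p) (cong (_% 2) (m<n⇒m/n≡0 {{m^n≢0 2 i}} q))

  e? : ∀ m i → Dec (e m i)
  e? m i = map′ is-one e.digit ((m / 2 ^ i) {{m^n≢0 2 i}} % 2 ≟ 1)

  elements : ℕ → List ℕ
  elements m = filter (e? m) (upTo m)

  elements⁺ : ∀ {m i} → i ∈ e m → i ∈ˡ elements m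
  elements⁺ {m} p = ∈-filter⁺ (e? m) (∈-upTo⁺ (e⇒< p)) p

  elements⁻ : ∀ {m i} → i ∈ˡ elements m → i ∈ e m
  elements⁻ {m} p = proj₂ (∈-filter⁻ (e? m) {xs = upTo m} p)

  e-∪ : ∀ p q → ∃[ r ] (e p ⊆ e r) × (e q ⊆ e r) × (∀ {X : Pred ℕ 0ℓ} → e p ⊆ X → e q ⊆ X → e r ⊆ X)
  e-∪ p q = code (elements p ++ elements q)
    , (λ z → e-code⁺ (∈-++⁺ˡ (elements⁺ z)))
    , (λ z → e-code⁺ (∈-++⁺ʳ (elements p) (elements⁺ z)))
    , λ {X} f g z → [ (λ w → f (elements⁻ w)) , (λ w → g (elements⁻ w)) ]′
                      (∈-++⁻ (elements p) (e-code⁻ z))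

-- Only the bijectivity of the pairing matters, so it is a parameter.
module GraphModel (pairing : (ℕ × ℕ) ↔ ℕ) where
  open FiniteSets

  [_,_] : ℕ → ℕ → ℕ
  [ m , n ] = Inverse.to pairing (m , n)

  _∘_ : Pred ℕ 0ℓ → Pred ℕ 0ℓ → Pred ℕ 0ℓ
  (A ∘ B) n = ∃[ m ] ([ m , n ] ∈ A) × (e m ⊆ B)

  ∘-mono : ∀ {A A′ B B′} → A ⊆ A′ → B ⊆ B′ → (A ∘ B) ⊆ (A′ ∘ B′)
  ∘-mono p q {x} (m , r , s) = m , p {[ m , x ]} r , λ z → q (s z)

  ∘-cong : ∀ {A A′ B B′} → A ≐ A′ → B ≐ B′ → (A ∘ B) ≐ (A′ ∘ B′)
  ∘-cong {A} {A′} {B} {B′} (p , p′) (q , q′) = ∘-mono {A} {A′} {B} {B′} p q , ∘-mono {A′} {A} {B′} {B} p′ q′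

  structure : PartialApplicativeStructure (lsuc 0ℓ) 0ℓ 0ℓ
  structure = record
    { Carrier       = Pred ℕ 0ℓ
    ; _≈_           = _≐_
    ; isEquivalence = ≐-isEquivalence
    ; _·_↦_         = λ A B X → (A ∘ B) ≐ X
    ; ·-resp        = λ p q r s → ≐-trans (≐-sym (∘-cong p q)) (≐-trans s r)
    ; ·-functional  = λ p q → ≐-trans (≐-sym p) q
    }

  [,]-injective : ∀ {m n m′ n′} → [ m , n ] ≡ [ m′ , n′ ] → (m , n) ≡ (m′ , n′)
  [,]-injective = Injection.injective (↔⇒↣ pairing)

  Λ : (Pred ℕ 0ℓ → Pred ℕ 0ℓ) → Pred ℕ 0ℓ
  Λ Φ i = ∃[ m ] ∃[ n ] (i ≡ [ m , n ]) × (n ∈ Φ (e m))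

  record Continuous (Φ : Pred ℕ 0ℓ → Pred ℕ 0ℓ) : Set₁ where
    field
      mono   : ∀ {A B} → A ⊆ B → Φ A ⊆ Φ B
      finite : ∀ {A n} → n ∈ Φ A → ∃[ m ] (e m ⊆ A) × (n ∈ Φ (e m))

    finite* : ∀ {A} L → (∀ {n} → n ∈ˡ L → n ∈ Φ A) →
              ∃[ m ] (e m ⊆ A) × (∀ {n} → n ∈ˡ L → n ∈ Φ (e m))
    finite* []      h = 0 , (λ z → ⊥-elim (e-0 z)) , λ ()
    finite* (x ∷ L) h with finite (h (here refl)) | finite* L (λ z → h (there z))
    ... | p , p⊆ , hp | q , q⊆ , hq with e-∪ p q
    ... | r , p⊆r , q⊆r , univ = r , univ p⊆ q⊆ ,
          λ { (here refl) → mono p⊆r hp ; (there z) → mono q⊆r (hq z) }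

  open Continuous

  β : ∀ {Φ} → Continuous Φ → ∀ B → (Λ Φ ∘ B) ≐ Φ B
  β {Φ} c B = to , from
    where
    to : (Λ Φ ∘ B) ⊆ Φ B
    to (m , (m′ , n′ , eq , p) , q) with refl ← [,]-injective eq = mono c q p
    from : Φ B ⊆ (Λ Φ ∘ B)
    from p with m , q , r ← finite c p = m , (m , _ , refl , r) , q

  id-continuous : Continuous (λ A → A)
  id-continuous .mono p = p
  id-continuous .finite {A} {n} p = code (n ∷ []) ,
    (λ z → singleton (e-code⁻ {n ∷ []} z)) , e-code⁺ {n ∷ []} (here refl)
    where
    singleton : ∀ {i} → i ∈ˡ (n ∷ []) → i ∈ A
    singleton (here refl) = p

  const-continuous : ∀ X → Continuous (λ _ → X)
  const-continuous X .mono p q = q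
  const-continuous X .finite p = 0 , (λ z → ⊥-elim (e-0 z)) , p

  ∘-continuous : ∀ {Φ Ψ} → Continuous Φ → Continuous Ψ → Continuous (λ A → Φ A ∘ Ψ A)
  ∘-continuous {Φ} {Ψ} c d .mono {A} {B} p = ∘-mono {Φ A} {Φ B} {Ψ A} {Ψ B} (mono c p) (mono d p)
  ∘-continuous c d .finite (m , p , q)
    with finite c p | finite* d (elements m) (λ z → q (elements⁻ z))
  ... | r , r⊆ , hr | s , s⊆ , hs with e-∪ r s
  ... | t , r⊆t , s⊆t , univ = t , univ r⊆ s⊆ , m
      , mono c r⊆t hr
      , λ z → mono d s⊆t (hs (elements⁺ {m} z))

  Λ-continuous : ∀ {Φ : Pred ℕ 0ℓ → Pred ℕ 0ℓ → Pred ℕ 0ℓ} →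
                 (∀ B → Continuous (λ A → Φ A B)) → Continuous (λ A → Λ (Φ A))
  Λ-continuous c .mono p (m , n , eq , q) = m , n , eq , mono (c (e m)) p q
  Λ-continuous c .finite (m , n , eq , q) with r , r⊆ , h ← finite (c (e m)) q =
    r , r⊆ , m , n , eq , h

  K S : Pred ℕ 0ℓ
  K = Λ λ A → Λ λ B → A
  S = Λ λ A → Λ λ B → Λ λ C → (A ∘ C) ∘ (B ∘ C)

  isPCA : IsPCA structure
  isPCA = record
    { k     = K
    ; s     = S
    ; k-law = λ A B → Λ (λ _ → A) , Kβ A , A , β (const-continuous A) B , Level.lift ≐-refl
    ; s-def = λ A B → S₂ A B , S₁ A , Sβ A , S₂ A B , S₁β A B , Level.lift ≐-refl
    ; s-law = λ {A} {B} {C} {X} {Y} {Z} p q r →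
        S₁ A , Sβ A , S₂ A B , S₁β A B , Z
        , ≐-trans (β (S-continuous A B) C) (≐-trans (∘-cong p q) r) , Level.lift ≐-refl
    }
    where
    S₁ : Pred ℕ 0ℓ → Pred ℕ 0ℓ
    S₁ A = Λ λ B → Λ λ C → (A ∘ C) ∘ (B ∘ C)
    S₂ : Pred ℕ 0ℓ → Pred ℕ 0ℓ → Pred ℕ 0ℓ
    S₂ A B = Λ λ C → (A ∘ C) ∘ (B ∘ C)

    Kβ : ∀ A → (K ∘ A) ≐ Λ (λ _ → A)
    Kβ A = β (Λ-continuous {λ A _ → A} (λ _ → id-continuous)) A

    S-continuous : ∀ A B → Continuous (λ C → (A ∘ C) ∘ (B ∘ C))
    S-continuous A B = ∘-continuous (∘-continuous (const-continuous A) id-continuous) (∘-continuous (const-continuous B) id-continuous)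

    S₁β : ∀ A B → (S₁ A ∘ B) ≐ S₂ A B
    S₁β A = β (Λ-continuous {λ B C → (A ∘ C) ∘ (B ∘ C)} λ C →
      ∘-continuous (∘-continuous (const-continuous A) (const-continuous C)) (∘-continuous id-continuous (const-continuous C)))

    Sβ : ∀ A → (S ∘ A) ≐ S₁ A
    Sβ = β (Λ-continuous {λ A B → S₂ A B} λ B → Λ-continuous {λ A C → (A ∘ C) ∘ (B ∘ C)} λ C →
      ∘-continuous (∘-continuous id-continuous (const-continuous C)) (∘-continuous (const-continuous B) (const-continuous C)))

  𝒫ℕ : PCA (lsuc 0ℓ) 0ℓ 0ℓ
  𝒫ℕ = record { structure = structure ; isPCA = isPCA }

  complement : PartialFunction 𝒫ℕ 0ℓ
  complement = record
    { _↦_        = λ A B → ∁ A ≐ B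
    ; resp       = λ p q r → ≐-trans (≐-sym (∁-cong p)) (≐-trans r q)
    ; functional = λ p q → ≐-trans (≐-sym p) q
    }
    where
    ∁-cong : ∀ {A A′ : Pred ℕ 0ℓ} → A ≐ A′ → ∁ A ≐ ∁ A′
    ∁-cong (p , q) = (λ z w → z (q w)) , (λ z w → z (p w))

{-# OPTIONS --safe #-}
-- Application in 𝒫ℕ is total, and for a total pca A the pca structure of A[f] is obtained by
-- simulation: to compute (ac)(bc) one simulates first a on c, then b on c, then the result of the
-- former on the result of the latter, consuming the list of oracle answers from left to right.
--
-- Equality of x and y is decided with three queries. The answers ∁x and ∁y yield, continuously,
-- the set w which is all of ℕ if x meets ∁y or ∁x meets y, and empty otherwise. By excluded middle,
-- w is inhabited if x ≠ y, and ∁w is inhabited if x = y, so that the set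
-- { n ∈ T | ∁w inhabited } ∪ { n ∈ F | w inhabited } is the truth value wanted.
module Submission where

open import Defs
open import Axiom.ExcludedMiddle using (ExcludedMiddle)
open import Data.Empty using (⊥-elim)
open import Data.Fin using (Fin; zero; suc; toℕ; #_)
open import Data.List using (List; []; _∷_; _++_; _∷ʳ_; length)
import Data.List as List
open import Data.List.Properties using (∷ʳ-++; ++-identityʳ; length-++-sucʳ)
open import Data.Nat using (ℕ; zero; suc; pred; _+_)
open import Data.Product using (Σ-syntax; ∃-syntax; _×_; _,_; proj₁; proj₂)
open import Data.Sum using (_⊎_; inj₁; inj₂)
open import Data.Vec using (Vec; []; _∷_)
import Data.Vec as Vec
open import Function using (_↔_)
open import Level using (Level; 0ℓ; _⊔_; lift)
open import Relation.Binary.PropositionalEquality using (_≡_; refl; sym; trans; cong; subst)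
open import Relation.Nullary using (¬_; yes; no)
open import Relation.Unary using (Pred; _∈_; _⊆_; _≐_; _∪_; _∩_; ∁; U)
open import Relation.Unary.Properties using (≐-refl; ≐-trans)

private
  variable
    c ℓ₁ ℓ₂ ℓ₃ : Level

-- The index comes as a `Fin` together with its value, because `projection` is specified for indices
-- of that form.
lookup-++ : ∀ {X : Set c} (as : List X) b bs →
            Σ[ i ∈ Fin (length (as ++ b ∷ bs)) ]
              (toℕ i ≡ length as) × (List.lookup (as ++ b ∷ bs) i ≡ b)
lookup-++ []       b bs = zero , refl , refl
lookup-++ (_ ∷ as) b bs with i , p , q ← lookup-++ as b bs = suc i , cong suc p , q

-- Elements `k a` and `s a b` of a partial combinatory algebra.

module Combinators (A : PCA c ℓ₁ ℓ₂) where
  open PCA A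

  -- This is `k a`, the intermediate value in `k a a`; functionality of application identifies it
  -- with the one in `k a b` for any `b`.
  K[_] : Carrier → Carrier
  K[ a ] = proj₁ (k-law a a)

  K-law : ∀ a b → K[ a ] · b ↦ a
  K-law a b with _ , p , _ ← k-law a a | _ , q , _ , r , lift h ← k-law a b =
    ·-resp (·-functional q p) ≈-refl h r

  S[_,_] : Carrier → Carrier → Carrier
  S[ a , b ] = proj₁ (s-def a b)

  S-law : ∀ {a b d x y z} → a · d ↦ x → b · d ↦ y → x · y ↦ z → S[ a , b ] · d ↦ z
  S-law {a} {b} p q r
    with _ , _ , p₁ , _ , p₂ , lift h ← s-def a b | _ , q₁ , _ , q₂ , _ , q₃ , lift h′ ← s-law p q r =
    ·-resp (≈-trans (·-functional (·-resp (·-functional q₁ p₁) ≈-refl ≈-refl q₂) p₂) h) ≈-refl h′ q₃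

-- Combinatory completeness of a total pca.

module TotalPCA (A : PCA c ℓ₁ ℓ₂)
                (total : ∀ a b → ∃[ x ] PCA._·_↦_ A a b x) where
  open PCA A public

  infixl 25 _∙_
  _∙_ : Carrier → Carrier → Carrier
  a ∙ b = proj₁ (total a b)

  ↦⇒≈ : ∀ {a b x} → a · b ↦ x → a ∙ b ≈ x
  ↦⇒≈ = ·-functional (proj₂ (total _ _))

  ≈⇒↦ : ∀ {a b x} → a ∙ b ≈ x → a · b ↦ x
  ≈⇒↦ p = ·-resp ≈-refl ≈-refl p (proj₂ (total _ _))

  infixl 7 _⟨∙⟩_ _⟨∙_
  _⟨∙⟩_ : ∀ {a a′ b b′} → a ≈ a′ → b ≈ b′ → a ∙ b ≈ a′ ∙ b′
  p ⟨∙⟩ q = ↦⇒≈ (·-resp (≈-sym p) (≈-sym q) ≈-refl (proj₂ (total _ _)))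

  _⟨∙_ : ∀ {a a′} → a ≈ a′ → ∀ b → a ∙ b ≈ a′ ∙ b
  p ⟨∙ b = p ⟨∙⟩ ≈-refl

  infixl 25 _∙*_ _∙ᴿ_
  _∙*_ : ∀ {n} → Carrier → Vec Carrier n → Carrier
  a ∙* []      = a
  a ∙* (b ∷ v) = (a ∙ b) ∙* v

  ∙*-congˡ : ∀ {n a a′} (v : Vec Carrier n) → a ≈ a′ → a ∙* v ≈ a′ ∙* v
  ∙*-congˡ []      p = p
  ∙*-congˡ (b ∷ v) p = ∙*-congˡ v (p ⟨∙ b)

  ↦*⇒≈ : ∀ {n a x} (v : Vec Carrier n) → a ·* v ↦ x → a ∙* v ≈ x
  ↦*⇒≈ []      (lift p)     = p
  ↦*⇒≈ (b ∷ v) (_ , p , ps) = ≈-trans (∙*-congˡ v (↦⇒≈ p)) (↦*⇒≈ v ps)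

  infixl 7 _$_
  -- Since application is total, every term denotes an element in every environment, and β-equality
  -- carries no definedness conditions.
  data Tm (n : ℕ) : Set c where
    var : Fin n → Tm n
    con : Carrier → Tm n
    _$_ : Tm n → Tm n → Tm n

  eval : ∀ {n} → Tm n → Vec Carrier n → Carrier
  eval (var i) ρ = Vec.lookup ρ i
  eval (con a) ρ = a
  eval (t $ u) ρ = eval t ρ ∙ eval u ρ

  -- Bracket abstraction of the innermost variable, with `s k k` as the identity.
  ƛ : ∀ {n} → Tm (suc n) → Tm n
  ƛ (var zero)    = con s $ con k $ con k
  ƛ (var (suc i)) = con k $ var i
  ƛ (con a)       = con k $ con a
  ƛ (t $ u)       = con s $ ƛ t $ ƛ u

  k-≈ : ∀ a b → k ∙ a ∙ b ≈ a
  k-≈ a b = ↦*⇒≈ (a ∷ b ∷ []) (k-law a b)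

  s-≈ : ∀ a b d → s ∙ a ∙ b ∙ d ≈ a ∙ d ∙ (b ∙ d)
  s-≈ a b d = ↦*⇒≈ (a ∷ b ∷ d ∷ [])
    (s-law (proj₂ (total a d)) (proj₂ (total b d)) (proj₂ (total (a ∙ d) (b ∙ d))))

  ƛ-β : ∀ {n} (t : Tm (suc n)) ρ b → eval (ƛ t) ρ ∙ b ≈ eval t (b ∷ ρ)
  ƛ-β (var zero)    ρ b = ≈-trans (s-≈ k k b) (k-≈ b (k ∙ b))
  ƛ-β (var (suc i)) ρ b = k-≈ _ b
  ƛ-β (con a)       ρ b = k-≈ a b
  ƛ-β (t $ u)       ρ b = ≈-trans (s-≈ _ _ b) (ƛ-β t ρ b ⟨∙⟩ ƛ-β u ρ b)

  ƛ* : ∀ {n} m → Tm (m + n) → Tm n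
  ƛ* zero    t = t
  ƛ* (suc m) t = ƛ* m (ƛ t)

  -- The last argument comes first in the vector, as in an environment.
  _∙ᴿ_ : ∀ {n} → Carrier → Vec Carrier n → Carrier
  a ∙ᴿ []      = a
  a ∙ᴿ (b ∷ v) = (a ∙ᴿ v) ∙ b

  ƛ*-β : ∀ {m n} (t : Tm (m + n)) (v : Vec Carrier m) ρ →
         eval (ƛ* m t) ρ ∙ᴿ v ≈ eval t (v Vec.++ ρ)
  ƛ*-β t []      ρ = ≈-refl
  ƛ*-β t (b ∷ v) ρ = ≈-trans (ƛ*-β (ƛ t) v ρ ⟨∙ b) (ƛ-β t (v Vec.++ ρ) b)

-- Programs on booleans, numerals and sequences.

module WithCoding (A : PCA c ℓ₁ ℓ₂)
                  (total : ∀ a b → ∃[ x ] PCA._·_↦_ A a b x)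
                  (C : Coding A) where
  open TotalPCA A total public
  open Coding C public

  pr π₁ π₂ ap nth suc# pred# zero# len# : Carrier
  pr    = proj₁ pairing
  π₁    = proj₁ fst
  π₂    = proj₁ snd
  ap    = proj₁ append
  nth   = proj₁ projection
  suc#  = proj₁ successor
  pred# = proj₁ predecessor
  zero# = proj₁ zero-test
  len#  = proj₁ len

  pr-≈ : ∀ {a b} → pr ∙ a ∙ b ≈ ⟦ a , b ⟧
  pr-≈ = ↦*⇒≈ (_ ∷ _ ∷ []) (proj₂ pairing _ _)

  π₁-≈ : ∀ {p a b} → p ≈ ⟦ a , b ⟧ → π₁ ∙ p ≈ a
  π₁-≈ q = ≈-trans (≈-refl ⟨∙⟩ q) (↦⇒≈ (proj₂ fst _ _))

  π₂-≈ : ∀ {p a b} → p ≈ ⟦ a , b ⟧ → π₂ ∙ p ≈ b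
  π₂-≈ q = ≈-trans (≈-refl ⟨∙⟩ q) (↦⇒≈ (proj₂ snd _ _))

  ap-≈ : ∀ {as a} → ap ∙ seq as ∙ a ≈ seq (as ∷ʳ a)
  ap-≈ = ↦*⇒≈ (_ ∷ _ ∷ []) (proj₂ append _ _)

  nth-≈ : ∀ as i → nth ∙ seq as ∙ num (toℕ i) ≈ List.lookup as i
  nth-≈ as i = ↦*⇒≈ (_ ∷ _ ∷ []) (proj₂ projection as i)

  nth-++ : ∀ as b bs → nth ∙ seq (as ++ b ∷ bs) ∙ num (length as) ≈ b
  nth-++ as b bs with i , p , q ← lookup-++ as b bs =
    subst (λ n → nth ∙ seq (as ++ b ∷ bs) ∙ num n ≈ b) p
      (subst (nth ∙ seq (as ++ b ∷ bs) ∙ num (toℕ i) ≈_) q (nth-≈ (as ++ b ∷ bs) i))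

  len-≈ : ∀ {as} → len# ∙ seq as ≈ num (length as)
  len-≈ = ↦⇒≈ (proj₂ len _)

  suc-≈ : ∀ {n} → suc# ∙ num n ≈ num (suc n)
  suc-≈ = ↦⇒≈ (proj₂ successor _)

  pred-≈ : ∀ {a n} → a ≈ num n → pred# ∙ a ≈ num (pred n)
  pred-≈ p = ≈-trans (≈-refl ⟨∙⟩ p) (↦⇒≈ (proj₂ predecessor _))

  zero-T : ∀ {a} → a ≈ num 0 → zero# ∙ a ≈ T
  zero-T p = ≈-trans (≈-refl ⟨∙⟩ p) (↦⇒≈ (proj₁ (proj₂ zero-test)))

  zero-F : ∀ {a n} → a ≈ num (suc n) → zero# ∙ a ≈ F
  zero-F p = ≈-trans (≈-refl ⟨∙⟩ p) (↦⇒≈ (proj₂ (proj₂ zero-test) _))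

  if-T : ∀ {t a b} → t ≈ T → D ∙ t ∙ a ∙ b ≈ a
  if-T p = ≈-trans (≈-refl ⟨∙⟩ p ⟨∙ _ ⟨∙ _) (↦*⇒≈ (_ ∷ _ ∷ _ ∷ []) (D-true _ _))

  if-F : ∀ {t a b} → t ≈ F → D ∙ t ∙ a ∙ b ≈ b
  if-F p = ≈-trans (≈-refl ⟨∙⟩ p ⟨∙ _ ⟨∙ _) (↦*⇒≈ (_ ∷ _ ∷ _ ∷ []) (D-false _ _))

  infix 5 if_then_else_
  -- Both branches are evaluated whichever is chosen; totality makes this harmless, so no branch has
  -- to be delayed.
  if_then_else_ : ∀ {n} → Tm n → Tm n → Tm n → Tm n
  if t then u else v = con D $ t $ u $ v

  ⟪_,_⟫ : ∀ {n} → Tm n → Tm n → Tm n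
  ⟪ t , u ⟫ = con pr $ t $ u

  infixl 8 _!_
  _!_ : ∀ {n} → Tm n → ℕ → Tm n
  t ! i = con nth $ t $ con (num i)

  cases : ∀ {n m} → Tm n → Vec (Tm n) (suc m) → Tm n
  cases t (u ∷ [])         = u
  cases t (u ∷ us@(_ ∷ _)) = if con zero# $ t then u else cases (con pred# $ t) us

  cases-≈ : ∀ {n m} (t : Tm n) (us : Vec (Tm n) (suc m)) ρ i → eval t ρ ≈ num (toℕ i) →
            eval (cases t us) ρ ≈ eval (Vec.lookup us i) ρ
  cases-≈ t (u ∷ [])         ρ zero    p = ≈-refl
  cases-≈ t (u ∷ us@(_ ∷ _)) ρ zero    p = if-T (zero-T p)
  cases-≈ t (u ∷ us@(_ ∷ _)) ρ (suc i) p =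
    ≈-trans (if-F (zero-F p)) (cases-≈ (con pred# $ t) us ρ i (pred-≈ p))

  -- Simulation of a run on stored oracle answers.

  -- L a K p σ i r continues a run of a, whose history is p, with the r last entries of σ, the
  -- first of which has index i, as oracle answers; if a halts, K takes over.
  private
    L-step : Tm 7
    L-step =
      if con π₁ $ (a $ p) then K $ (con π₂ $ (a $ p)) $ σ $ i $ r else
      (if con zero# $ r then a $ p else
       l $ l $ a $ K $ (con ap $ p $ (con nth $ σ $ i)) $ σ $ (con suc# $ i) $ (con pred# $ r))
      where
      l a K p σ i r : Tm 7
      l = var (# 6)
      a = var (# 5)
      K = var (# 4)
      p = var (# 3)
      σ = var (# 2)
      i = var (# 1)
      r = var (# 0)

    L′ : Carrier
    L′ = eval (ƛ* 7 L-step) []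

  L : Carrier
  L = L′ ∙ L′

  -- Recursion by self-application: `L-step` receives `L′` as `l`, and its recursive call `l $ l` is
  -- `L` again.
  L-unfold : ∀ {a K p σ i r} → L ∙ a ∙ K ∙ p ∙ σ ∙ i ∙ r ≈
             D ∙ (π₁ ∙ (a ∙ p)) ∙ (K ∙ (π₂ ∙ (a ∙ p)) ∙ σ ∙ i ∙ r) ∙
             (D ∙ (zero# ∙ r) ∙ (a ∙ p) ∙
              (L ∙ a ∙ K ∙ (ap ∙ p ∙ (nth ∙ σ ∙ i)) ∙ σ ∙ (suc# ∙ i) ∙ (pred# ∙ r)))
  L-unfold {a} {K} {p} {σ} {i} {r} = ƛ*-β L-step (r ∷ i ∷ σ ∷ p ∷ K ∷ a ∷ L′ ∷ []) []

  L-halt : ∀ {a K p x σ i r} → a ∙ p ≈ ⟦ T , x ⟧ →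
           L ∙ a ∙ K ∙ p ∙ σ ∙ i ∙ r ≈ K ∙ x ∙ σ ∙ i ∙ r
  L-halt h = ≈-trans L-unfold
    (≈-trans (if-T (π₁-≈ h)) (≈-refl ⟨∙⟩ π₂-≈ h ⟨∙ _ ⟨∙ _ ⟨∙ _))

  L-query : ∀ {a K p x σ i} → a ∙ p ≈ ⟦ F , x ⟧ →
            L ∙ a ∙ K ∙ p ∙ σ ∙ i ∙ num 0 ≈ ⟦ F , x ⟧
  L-query h = ≈-trans L-unfold
    (≈-trans (if-F (π₁-≈ h)) (≈-trans (if-T (zero-T ≈-refl)) h))

  L-answer : ∀ {a K x} as bs b cs → a ∙ seq as ≈ ⟦ F , x ⟧ →
             L ∙ a ∙ K ∙ seq as ∙ seq (bs ++ b ∷ cs) ∙ num (length bs) ∙ num (suc (length cs)) ≈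
             L ∙ a ∙ K ∙ seq (as ∷ʳ b) ∙ seq (bs ++ b ∷ cs) ∙ num (suc (length bs)) ∙ num (length cs)
  L-answer as bs b cs h = ≈-trans L-unfold
    (≈-trans (if-F (π₁-≈ h)) (≈-trans (if-F (zero-F ≈-refl))
      (≈-refl ⟨∙⟩ ≈-trans (≈-refl ⟨∙⟩ nth-++ bs b cs) ap-≈ ⟨∙ _ ⟨∙⟩ suc-≈ ⟨∙⟩ pred-≈ ≈-refl)))

-- Computations with an oracle.

module AdjoinTotal (A : PCA c ℓ₁ ℓ₂)
                   (total : ∀ a b → ∃[ x ] PCA._·_↦_ A a b x)
                   (C : Coding A) (f : PartialFunction A ℓ₃) where
  open WithCoding A total C public
  open PartialFunction f
  open Adjoin A C f using (_·ᶠ_↦_; Run; run; firstQuery; rest)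

  -- The inductive form of a run: after the first answer the rest is again a computation, so
  -- simulations can recurse on it.
  data Computes (a : Carrier) (as : List Carrier) (x : Carrier) : Set (c ⊔ ℓ₁ ⊔ ℓ₃) where
    halts : a ∙ seq as ≈ ⟦ T , x ⟧ → Computes a as x
    asks  : ∀ {e d} → a ∙ seq as ≈ ⟦ F , e ⟧ → e ↦ d → Computes a (as ∷ʳ d) x → Computes a as x

  run⇒computes : ∀ {a as n x} → Run a as n x → Computes a as x
  run⇒computes {n = zero}  r = halts (↦⇒≈ (Run.query₀ r refl))
  run⇒computes {n = suc n} r =
    asks (↦⇒≈ (firstQuery r)) (Run.value r zero) (run⇒computes (rest r))

  computes⇒run : ∀ {a as x} → Computes a as x → ∃[ n ] Run a as n x
  computes⇒run {a} {as} (halts h) = 0 , run (λ ()) (λ ()) (λ ()) (λ ())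
    (subst (λ l → a · seq l ↦ _) (sym (++-identityʳ as)) (≈⇒↦ h))
  computes⇒run {a} {as} (asks {e₀} {d₀} q v c) with n , run e d vs qs h ← computes⇒run c =
    suc n , run
      (λ { zero → e₀ ; (suc i) → e i })
      (λ { zero → d₀ ; (suc i) → d i })
      (λ { zero → v ; (suc i) → vs i })
      (λ { zero → subst (λ l → a · seq l ↦ _) (sym (++-identityʳ as)) (≈⇒↦ q)
         ; (suc i) → subst (λ l → a · seq l ↦ _) (∷ʳ-++ as _ _) (qs i) })
      (subst (λ l → a · seq l ↦ _) (∷ʳ-++ as _ _) h)

  fromComputes : ∀ {a b x} → Computes a (b ∷ []) x → a ·ᶠ b ↦ x
  fromComputes p with n , run e d v q h ← computes⇒run p = n , e , d , v , q , h

  toComputes : ∀ {a b x} → a ·ᶠ b ↦ x → Computes a (b ∷ []) x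
  toComputes (_ , e , d , v , q , h) = run⇒computes (run e d v q h)

  module _ {g z : Carrier} where
    -- An element of `A[f]` restarts on a longer list after each answer. Hence the behaviour of `g`
    -- is assumed on every extension `bs ++ ds` of the part `bs` already consumed. Induction on the
    -- computation of `a` maintains this until `a` halts, and `cont` receives it with `K` in charge.
    simulate : ∀ {a K as bs x} → Computes a as x →
      (∀ ds → g ∙ seq (bs ++ ds) ≈
              L ∙ a ∙ K ∙ seq as ∙ seq (bs ++ ds) ∙ num (length bs) ∙ num (length ds)) →
      (∀ cs → (∀ ds → g ∙ seq (cs ++ ds) ≈
                      K ∙ x ∙ seq (cs ++ ds) ∙ num (length cs) ∙ num (length ds)) →
              Computes g cs z) →
      Computes g bs z
    simulate (halts h) eq cont = cont _ λ ds → ≈-trans (eq ds) (L-halt h)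
    simulate {a} {K} {as} {bs} (asks {d = d} q v c) eq cont = asks
      -- With `ds = []` nothing is left unread, so the query of `a` becomes a query of `g`; with
      -- `d ∷ ds` the simulator consumes the new answer.
      (≈-trans (subst (λ l → g ∙ seq l ≈ L ∙ a ∙ K ∙ seq as ∙ seq l ∙ num (length bs) ∙ num 0)
                       (++-identityʳ bs) (eq [])) (L-query q)) v
      (simulate c
        (λ ds → transport (∷ʳ-++ bs d ds) (length-∷ʳ bs)
                  (≈-trans (eq (d ∷ ds)) (L-answer as bs d ds q)))
        cont)
      where
      length-∷ʳ : ∀ bs → length (bs ∷ʳ d) ≡ suc (length bs)
      length-∷ʳ bs = trans (length-++-sucʳ bs d []) (cong (λ l → suc (length l)) (++-identityʳ bs))

      transport : ∀ {l l′ m m′ n} → l ≡ l′ → m ≡ m′ →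
        g ∙ seq l′ ≈ L ∙ a ∙ K ∙ seq (as ∷ʳ d) ∙ seq l′ ∙ num m′ ∙ n →
        g ∙ seq l ≈ L ∙ a ∙ K ∙ seq (as ∷ʳ d) ∙ seq l ∙ num m ∙ n
      transport refl refl p = p

  -- The combinators of `A[f]`.

  singleton : ∀ {n} → Tm n → Tm n
  singleton t = con ap $ con (seq []) $ t

  -- Continuations for L: K₁ b d x runs b on d after a has returned x on d, K₂ x y runs x on y, and
  -- K₃ returns the result.
  K₃-body : Tm 4
  K₃-body = ⟪ con T , var (# 3) ⟫

  K₃ : Carrier
  K₃ = eval (ƛ* 4 K₃-body) []

  K₂-body : Tm 5
  K₂-body = con L $ var (# 4) $ con K₃ $ singleton (var (# 3)) $ var (# 2) $ var (# 1) $ var (# 0)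

  K₂ : Carrier
  K₂ = eval (ƛ* 5 K₂-body) []

  K₁-body : Tm 6
  K₁-body = con L $ var (# 5) $ (con K₂ $ var (# 3)) $ singleton (var (# 4)) $
            var (# 2) $ var (# 1) $ var (# 0)

  K₁ : Carrier
  K₁ = eval (ƛ* 6 K₁-body) []

  -- In `A[f]` an element acts on a list that starts with its argument, so variables stand for lists
  -- and `! 0` reads off the argument itself.
  kᶠ-body : Tm 2
  kᶠ-body = ⟪ con T , var (# 1) ! 0 ⟫

  kᶠ : Carrier
  kᶠ = eval (ƛ ⟪ con T , ƛ kᶠ-body ⟫) []

  sᶠ-body : Tm 3
  sᶠ-body = con L $ a $ (con K₁ $ b $ d) $ singleton d $
            -- Entry 0 is the argument, so the answers start at index 1 and are one fewer than the
            -- length.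
            var (# 0) $ con (num 1) $ (con pred# $ (con len# $ var (# 0)))
    where
    a b d : Tm 3
    a = var (# 2) ! 0
    b = var (# 1) ! 0
    d = var (# 0) ! 0

  sᶠ : Carrier
  sᶠ = eval (ƛ ⟪ con T , ƛ ⟪ con T , ƛ sᶠ-body ⟫ ⟫) []

  value-·ᶠ : ∀ {n} (t : Tm (suc n)) ρ b →
             eval (ƛ ⟪ con T , t ⟫) ρ ·ᶠ b ↦ eval t (seq (b ∷ []) ∷ ρ)
  value-·ᶠ t ρ b = fromComputes (halts (≈-trans (ƛ-β ⟪ con T , t ⟫ ρ _) pr-≈))

  sᶠ-computes : ∀ {a b d x y z} →
    Computes a (d ∷ []) x → Computes b (d ∷ []) y → Computes x (y ∷ []) z →
    Computes (eval (ƛ sᶠ-body) (seq (b ∷ []) ∷ seq (a ∷ []) ∷ [])) (d ∷ []) z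
  sᶠ-computes {a} {b} {d} {x} {y} {z} p q r =
    simulate {K = K₁ ∙ b ∙ d} p start λ _ h₁ →
    simulate {K = K₂ ∙ x} q (λ ds → ≈-trans (h₁ ds) K₁-≈) λ _ h₂ →
    simulate {K = K₃} r (λ ds → ≈-trans (h₂ ds) K₂-≈) λ cs h₃ →
    halts (subst (λ l → _ ∙ seq l ≈ _) (++-identityʳ cs) (≈-trans (h₃ []) K₃-≈))
    where
    start : ∀ ds → eval (ƛ sᶠ-body) (seq (b ∷ []) ∷ seq (a ∷ []) ∷ []) ∙ seq (d ∷ ds) ≈
            L ∙ a ∙ (K₁ ∙ b ∙ d) ∙ seq (d ∷ []) ∙ seq (d ∷ ds) ∙ num 1 ∙ num (length ds)
    start ds = ≈-trans (ƛ-β sᶠ-body (seq (b ∷ []) ∷ seq (a ∷ []) ∷ []) (seq (d ∷ ds)))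
      (≈-refl ⟨∙⟩ nth-++ [] a [] ⟨∙⟩ (≈-refl ⟨∙⟩ nth-++ [] b [] ⟨∙⟩ nth-++ [] d ds)
       ⟨∙⟩ ≈-trans (≈-refl ⟨∙⟩ nth-++ [] d ds) ap-≈ ⟨∙ _ ⟨∙ _ ⟨∙⟩ pred-≈ len-≈)

    K₁-≈ : ∀ {σ i r} → K₁ ∙ b ∙ d ∙ x ∙ σ ∙ i ∙ r ≈ L ∙ b ∙ (K₂ ∙ x) ∙ seq (d ∷ []) ∙ σ ∙ i ∙ r
    K₁-≈ {σ} {i} {r} = ≈-trans (ƛ*-β K₁-body (r ∷ i ∷ σ ∷ x ∷ d ∷ b ∷ []) [])
      (≈-refl ⟨∙⟩ ap-≈ ⟨∙ _ ⟨∙ _ ⟨∙ _)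

    K₂-≈ : ∀ {σ i r} → K₂ ∙ x ∙ y ∙ σ ∙ i ∙ r ≈ L ∙ x ∙ K₃ ∙ seq (y ∷ []) ∙ σ ∙ i ∙ r
    K₂-≈ {σ} {i} {r} = ≈-trans (ƛ*-β K₂-body (r ∷ i ∷ σ ∷ y ∷ x ∷ []) [])
      (≈-refl ⟨∙⟩ ap-≈ ⟨∙ _ ⟨∙ _ ⟨∙ _)

    K₃-≈ : ∀ {σ i r} → K₃ ∙ z ∙ σ ∙ i ∙ r ≈ ⟦ T , z ⟧
    K₃-≈ {σ} {i} {r} = ≈-trans (ƛ*-β K₃-body (r ∷ i ∷ σ ∷ z ∷ []) []) pr-≈

  isPCA[f] : IsPCA (A [ C , f ])
  isPCA[f] = record
    { k     = kᶠ
    ; s     = sᶠ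
    ; k-law = λ a b → _ , value-·ᶠ (ƛ kᶠ-body) [] a , a
                    , fromComputes (halts (≈-trans (ƛ-β kᶠ-body (seq (a ∷ []) ∷ []) (seq (b ∷ [])))
                        (≈-trans (≈-refl ⟨∙⟩ nth-++ [] a []) pr-≈)))
                    , lift ≈-refl
    ; s-def = λ a b → _ , _ , value₁ a , _ , value₂ a b , lift ≈-refl
    ; s-law = λ {a} {b} p q r → _ , value₁ a , _ , value₂ a b , _
                    , fromComputes (sᶠ-computes (toComputes p) (toComputes q) (toComputes r))
                    , lift ≈-refl
    }
    where
    value₁ = value-·ᶠ (ƛ ⟪ con T , ƛ sᶠ-body ⟫) []
    value₂ = λ a → value-·ᶠ (ƛ sᶠ-body) (seq (a ∷ []) ∷ [])

  A[f] : PCA _ _ _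
  A[f] = mkPCA (A [ C , f ]) isPCA[f]

  -- An equality test by oracle queries.

  -- Here v compares x with y, and r t u turns the outcome and its image under f into t or u.
  module _
    (f-total : ∀ a → ∃[ b ] a ↦ b)
    (v : Carrier) (r : Carrier → Carrier → Carrier)
    (equal : ∀ {t u x x′ y y′ w′} → x ↦ x′ → y ↦ y′ → (v ∙ x ∙ x′ ∙ y ∙ y′) ↦ w′ →
             x ≈ y → r t u ∙ (v ∙ x ∙ x′ ∙ y ∙ y′) ∙ w′ ≈ t)
    (unequal : ∀ {t u x x′ y y′ w′} → x ↦ x′ → y ↦ y′ → (v ∙ x ∙ x′ ∙ y ∙ y′) ↦ w′ →
               ¬ (x ≈ y) → r t u ∙ (v ∙ x ∙ x′ ∙ y ∙ y′) ∙ w′ ≈ u)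
    where

    -- The outcomes are parameters because they will be booleans chosen in `A[f]`, which may differ
    -- from the `T` and `F` that steer runs.
    module _ (t u : Carrier) where
      private
        -- The outer list holds only `x`, the argument of the first application; the inner one grows
        -- from `y` to `y`, `x′`, `y′`, `w′`.
        X Y X′ Y′ W′ W : Tm 2
        X  = var (# 1) ! 0
        Y  = var (# 0) ! 0
        X′ = var (# 0) ! 1
        Y′ = var (# 0) ! 2
        W′ = var (# 0) ! 3
        W  = con v $ X $ X′ $ Y $ Y′

        count : Tm 2
        count = con pred# $ (con len# $ var (# 0))

        stages : Vec (Tm 2) 4
        stages = ⟪ con F , X ⟫ ∷ ⟪ con F , Y ⟫ ∷ ⟪ con F , W ⟫ ∷ ⟪ con T , con (r t u) $ W $ W′ ⟫ ∷ []

      test-body : Tm 2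
      test-body = cases count stages

      -- The argument `y` takes one place in the list, so `count` is the number of answers received,
      -- and it selects the next action.
      stage : ∀ {σ τ} (i : Fin 4) → toℕ i ≡ pred (length τ) →
              eval (ƛ test-body) (σ ∷ []) ∙ seq τ ≈ eval (Vec.lookup stages i) (seq τ ∷ σ ∷ [])
      stage {σ} {τ} i p = ≈-trans (ƛ-β test-body (σ ∷ []) (seq τ))
        (cases-≈ count stages (seq τ ∷ σ ∷ []) i (subst (λ n → _ ≈ num n) (sym p) (pred-≈ len-≈)))

      test : Carrier
      test = eval (ƛ ⟪ con T , ƛ test-body ⟫) []

      test-computes : ∀ {x x′ y y′ w′ b} → x ↦ x′ → y ↦ y′ → (v ∙ x ∙ x′ ∙ y ∙ y′) ↦ w′ →
                      r t u ∙ (v ∙ x ∙ x′ ∙ y ∙ y′) ∙ w′ ≈ b →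
                      Computes (eval (ƛ test-body) (seq (x ∷ []) ∷ [])) (y ∷ []) b
      test-computes {x} {x′} {y} {y′} {w′} p q s h =
        asks (≈-trans (stage (# 0) refl) (≈-trans (≈-refl ⟨∙⟩ nth-++ [] x []) pr-≈)) p
        (asks (≈-trans (stage (# 1) refl) (≈-trans (≈-refl ⟨∙⟩ nth-++ [] y _) pr-≈)) q
        (asks (≈-trans (stage (# 2) refl) (≈-trans (≈-refl ⟨∙⟩ W-≈ []) pr-≈)) s
        (halts (≈-trans (stage (# 3) refl)
          (≈-trans (≈-refl ⟨∙⟩ ≈-trans (≈-refl ⟨∙⟩ W-≈ _ ⟨∙⟩ nth-++ (y ∷ x′ ∷ y′ ∷ []) w′ []) h) pr-≈)))))
        where
        W-≈ : ∀ l → eval W (seq (y ∷ x′ ∷ y′ ∷ l) ∷ seq (x ∷ []) ∷ []) ≈ v ∙ x ∙ x′ ∙ y ∙ y′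
        W-≈ l = ≈-refl ⟨∙⟩ nth-++ [] x [] ⟨∙⟩ nth-++ (y ∷ []) x′ _ ⟨∙⟩ nth-++ [] y _
                ⟨∙⟩ nth-++ (y ∷ x′ ∷ []) y′ l

    decidable[f] : Decidable A[f]
    decidable[f] B P = d , λ { (p ∷ []) b (x , y , p≈ , h) → b , represents p≈ h , lift ≈-refl }
      where
      module B = Booleans B
      module P = Pairs P
      open Combinators A[f]

      d : Carrier
      -- As a function of `p` this is `test (fst p) (snd p)`, with the combinators of `A[f]` and the
      -- projections of the given pairing `P`.
      d = S[ S[ K[ test B.T B.F ] , proj₁ P.fst ] , proj₁ P.snd ]

      module _ {p b x y : Carrier} (p≈ : p ≈ P.⟦ x , y ⟧) where
        compose : ∀ {g} → test B.T B.F ·ᶠ x ↦ g → g ·ᶠ y ↦ b → d ·ᶠ p ↦ b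
        compose g h = PCA.·-resp A[f] ≈-refl (≈-sym p≈) ≈-refl
          (S-law (S-law (K-law _ _) (proj₂ P.fst x y) g) (proj₂ P.snd x y) h)

        represents : (x ≈ y × b ≈ B.T) ⊎ (¬ (x ≈ y) × b ≈ B.F) → d ·ᶠ p ↦ b
        represents h = compose (value-·ᶠ (ƛ (test-body B.T B.F)) [] x) (fromComputes
          (test-computes B.T B.F x↦ y↦ w↦ (value h)))
          where
          x↦ = proj₂ (f-total x)
          y↦ = proj₂ (f-total y)
          w↦ = proj₂ (f-total _)

          value : (x ≈ y × b ≈ B.T) ⊎ (¬ (x ≈ y) × b ≈ B.F) → _ ≈ b
          value (inj₁ (e , q)) = ≈-trans (equal x↦ y↦ w↦ e) (≈-sym q)
          value (inj₂ (e , q)) = ≈-trans (unequal x↦ y↦ w↦ e) (≈-sym q)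

-- Continuous comparison of sets in the graph model.

module Comparison (pairing : (ℕ × ℕ) ↔ ℕ) where
  open GraphModel pairing
  open Continuous
  open FiniteSets using (e-∪)

  _meets_ : Pred ℕ 0ℓ → Pred ℕ 0ℓ → Set
  A meets B = ∃[ i ] i ∈ A × i ∈ B

  ∪-continuous : ∀ {Φ Ψ} → Continuous Φ → Continuous Ψ → Continuous (λ A → Φ A ∪ Ψ A)
  ∪-continuous c d .mono p (inj₁ h) = inj₁ (mono c p h)
  ∪-continuous c d .mono p (inj₂ h) = inj₂ (mono d p h)
  ∪-continuous c d .finite (inj₁ h) with m , p , q ← finite c h = m , p , inj₁ q
  ∪-continuous c d .finite (inj₂ h) with m , p , q ← finite d h = m , p , inj₂ q

  -- By monotonicity, the union of the two finite parts serves both memberships.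
  finite₂ : ∀ {Φ Ψ} → Continuous Φ → Continuous Ψ → ∀ {A i j} → i ∈ Φ A → j ∈ Ψ A →
            ∃[ m ] (e m ⊆ A) × (i ∈ Φ (e m)) × (j ∈ Ψ (e m))
  finite₂ c d p q with r , r⊆ , hr ← finite c p | s , s⊆ , hs ← finite d q
    with t , r⊆t , s⊆t , univ ← e-∪ r s =
    t , univ r⊆ s⊆ , mono c r⊆t hr , mono d s⊆t hs

  ∩-continuous : ∀ {Φ Ψ} → Continuous Φ → Continuous Ψ → Continuous (λ A → Φ A ∩ Ψ A)
  ∩-continuous c d .mono p (h , h′) = mono c p h , mono d p h′
  ∩-continuous c d .finite (h , h′) = finite₂ c d h h′

  -- A common element is one witness and depends on finitely much of the argument. The truth value
  -- is coded as a set that is all of ℕ or empty.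
  meets-continuous : ∀ {Φ Ψ} → Continuous Φ → Continuous Ψ → Continuous (λ A _ → Φ A meets Ψ A)
  meets-continuous c d .mono p (i , h , h′) = i , mono c p h , mono d p h′
  meets-continuous c d .finite (i , h , h′) with m , p , q , q′ ← finite₂ c d h h′ = m , p , i , q , q′

  -- With complements at hand, inequality is a positive existential condition, hence continuous in
  -- the four sets.
  differ : Pred ℕ 0ℓ → Pred ℕ 0ℓ → Pred ℕ 0ℓ → Pred ℕ 0ℓ → Pred ℕ 0ℓ
  differ x x′ y y′ = (λ _ → x meets y′) ∪ (λ _ → x′ meets y)

  choose : Pred ℕ 0ℓ → Pred ℕ 0ℓ → Pred ℕ 0ℓ → Pred ℕ 0ℓ → Pred ℕ 0ℓ
  choose t u w w′ = ((λ _ → w′ meets U) ∩ t) ∪ ((λ _ → w meets U) ∩ u)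

  differ-continuous : ∀ {Φ Φ′ Ψ Ψ′} → Continuous Φ → Continuous Φ′ → Continuous Ψ → Continuous Ψ′ →
                      Continuous (λ A → differ (Φ A) (Φ′ A) (Ψ A) (Ψ′ A))
  differ-continuous c c′ d d′ = ∪-continuous (meets-continuous c d′) (meets-continuous c′ d)

  choose-continuous : ∀ {t u Φ Φ′} → Continuous Φ → Continuous Φ′ →
                      Continuous (λ A → choose t u (Φ A) (Φ′ A))
  choose-continuous c c′ = ∪-continuous
    (∩-continuous (meets-continuous c′ (const-continuous U)) (const-continuous _))
    (∩-continuous (meets-continuous c (const-continuous U)) (const-continuous _))

  v : Pred ℕ 0ℓ
  v = Λ λ x → Λ λ x′ → Λ λ y → Λ λ y′ → differ x x′ y y′

  r : Pred ℕ 0ℓ → Pred ℕ 0ℓ → Pred ℕ 0ℓ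
  r t u = Λ λ w → Λ λ w′ → choose t u w w′

  ∘-congˡ : ∀ {A A′} B → A ≐ A′ → (A ∘ B) ≐ (A′ ∘ B)
  ∘-congˡ B p = ∘-cong p (≐-refl {x = B})

  -- Each β-step treats one argument and needs continuity in that variable alone, the others being
  -- fixed.
  v-≐ : ∀ x x′ y y′ → ((((v ∘ x) ∘ x′) ∘ y) ∘ y′) ≐ differ x x′ y y′
  v-≐ x x′ y y′ =
    ≐-trans (∘-congˡ y′ (≐-trans (∘-congˡ y (≐-trans (∘-congˡ x′ β₁) β₂)) β₃)) β₄
    where
    β₁ = β (Λ-continuous {λ x x′ → Λ λ y → Λ λ y′ → differ x x′ y y′} λ x′ →
            Λ-continuous {λ x y → Λ λ y′ → differ x x′ y y′} λ y →
            Λ-continuous {λ x y′ → differ x x′ y y′} λ y′ →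
            differ-continuous id-continuous (const-continuous x′) (const-continuous y) (const-continuous y′)) x
    β₂ = β (Λ-continuous {λ x′ y → Λ λ y′ → differ x x′ y y′} λ y →
            Λ-continuous {λ x′ y′ → differ x x′ y y′} λ y′ →
            differ-continuous (const-continuous x) id-continuous (const-continuous y) (const-continuous y′)) x′
    β₃ = β (Λ-continuous {λ y y′ → differ x x′ y y′} λ y′ →
            differ-continuous (const-continuous x) (const-continuous x′) id-continuous (const-continuous y′)) y
    β₄ = β (differ-continuous (const-continuous x) (const-continuous x′) (const-continuous y) id-continuous) y′

  r-≐ : ∀ t u w w′ → ((r t u ∘ w) ∘ w′) ≐ choose t u w w′
  r-≐ t u w w′ = ≐-trans (∘-congˡ w′ β₁) β₂
    where
    β₁ = β (Λ-continuous {λ w w′ → choose t u w w′} λ w′ →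
            choose-continuous id-continuous (const-continuous w′)) w
    β₂ = β (choose-continuous (const-continuous w) id-continuous) w′

  module _ {t u x x′ y y′ w w′ : Pred ℕ 0ℓ} (x↦ : ∁ x ≐ x′) (y↦ : ∁ y ≐ y′) (w↦ : ∁ w ≐ w′)
           (w≐ : w ≐ differ x x′ y y′) where

    choose-equal : x ≐ y → choose t u w w′ ≐ t
    choose-equal (x⊆y , y⊆x) =
      (λ { (inj₁ (_ , h)) → h ; (inj₂ ((_ , h , _) , _)) → ⊥-elim (empty h) }) ,
      -- As `w` is empty, `w′` is all of ℕ, and 0 is an arbitrary witness.
      (λ h → inj₁ ((0 , proj₁ w↦ empty , _) , h))
      where
      empty : ∀ {i} → ¬ (i ∈ w)
      empty h with proj₁ w≐ h
      ... | inj₁ (_ , p , q) = proj₂ y↦ q (x⊆y p)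
      ... | inj₂ (_ , p , q) = proj₂ x↦ p (y⊆x q)

    choose-unequal : ExcludedMiddle 0ℓ → ¬ (x ≐ y) → choose t u w w′ ≐ u
    choose-unequal em x≢y =
      (λ { (inj₁ ((_ , h , _) , _)) → ⊥-elim (proj₂ w↦ h full) ; (inj₂ (_ , h)) → h }) ,
      (λ h → inj₂ ((0 , full , _) , h))
      where
      -- Membership in `differ` does not depend on `i`, so a single `i` outside `w` excludes every
      -- difference between `x` and `y`; excluded middle then gives both inclusions.
      full : ∀ {i} → i ∈ w
      full {i} with em {i ∈ w}
      ... | yes h = h
      ... | no ¬h = ⊥-elim (x≢y (x⊆y , y⊆x))
        where
        x⊆y : x ⊆ y
        x⊆y {j} p with em {j ∈ y}
        ... | yes q = q
        ... | no ¬q = ⊥-elim (¬h (proj₂ w≐ (inj₁ (j , p , proj₁ y↦ ¬q))))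
        y⊆x : y ⊆ x
        y⊆x {j} p with em {j ∈ x}
        ... | yes q = q
        ... | no ¬q = ⊥-elim (¬h (proj₂ w≐ (inj₂ (j , proj₁ x↦ ¬q , p))))

theorem2p4 : ExcludedMiddle 0ℓ →
    (pairing : (ℕ × ℕ) ↔ ℕ) →
    (C : Coding (GraphModel.𝒫ℕ pairing)) →
    Σ[ p ∈ IsPCA (GraphModel.𝒫ℕ pairing [ C , GraphModel.complement pairing ]) ]
    Decidable (mkPCA (GraphModel.𝒫ℕ pairing [ C , GraphModel.complement pairing ]) p)
theorem2p4 em pairing C = isPCA[f] , decidable[f] (λ a → ∁ a , ≐-refl) v r
  (λ {t} {u} {x} {x′} {y} {y′} p q s h →
    ≐-trans (r-≐ t u _ _) (choose-equal p q s (v-≐ x x′ y y′) h))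
  (λ {t} {u} {x} {x′} {y} {y′} p q s h →
    ≐-trans (r-≐ t u _ _) (choose-unequal p q s (v-≐ x x′ y y′) em h))
  where
  open GraphModel pairing using (_∘_; 𝒫ℕ; complement)
  open Comparison pairing
  open AdjoinTotal 𝒫ℕ (λ A B → A ∘ B , ≐-refl) C complement using (isPCA[f]; decidable[f])
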